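{- There are continuum-many equational theories of classes of idempotent $0$-semifields; that is, the set $\{\mathrm{Eq}(\mathsf{K})\mid \mathsf{K}\text{ is a class of idempotent }0\text{ -semifields}\}$ has cardinality $2^{\aleph_0}$.
   Context: An idempotent semiring is an algebraic structure $\langle S,\vee,\cdot,\mathrm{e}\rangle$ such that $\langle S,\cdot,\mathrm{e}\rangle$ is a monoid, $\langle S,\vee\rangle$ is a semilattice (an idempotent commutative semigroup), and $a(b\vee c)d=abd\vee acd$ for all $a,b,c,d\in S$; it is ordered by $a\le b :\Longleftrightarrow a\vee b=b$. An idempotent $0$-semiring is an algebraic structure $\langle F,\vee,\cdot,\mathrm{e},0\rangle$ such that $\langle F,\vee,\cdot,\mathrm{e}\rangle$ is an idempotent semiring with least element $0$; it is an idempotent $0$-semifield if, additionally, $\langle F\setminus\{0\},\cdot,\mathrm{e}\rangle$ is the monoid reduct of a group. Terms are built from a countably infinite set of variables; an equation $s\approx t$ is satisfied by an algebra $\mathbf{A}$ if $\varphi(s)=\varphi(t)$ for every homomorphism $\varphi$ from the term algebra to $\mathbf{A}$. $\mathrm{Eq}(\mathsf{K})$ is the set of all equations in the signature $\{\vee,\cdot,\mathrm{e},0\}$ satisfied by all members of $\mathsf{K}$. -}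

module Defs where

open import Level using (_⊔_; suc; 0ℓ)
open import Algebra.Core using (Op₁; Op₂)
open import Algebra.Bundles.Raw using (RawSemiring)
open import Algebra.Structures using (IsMonoid; IsGroup)
open import Algebra.Lattice.Structures using (IsSemilattice)
open import Algebra.Morphism.Structures using (IsSemiringHomomorphism)
open import Data.Nat.Base using (ℕ)
open import Data.Product.Base using (∃; _×_; _,_; proj₁)
open import Function.Base using (_on_)
open import Relation.Binary.Bundles using (Setoid)
open import Relation.Binary.Core using (Rel)
open import Relation.Binary.Definitions using (Minimum)
import Relation.Binary.Construct.On as On
open import Relation.Binary.PropositionalEquality.Core using (_≡_)
open import Relation.Nullary.Negation.Core using (¬_)
open import Relation.Unary using (Pred; _≐_)
open import Relation.Unary.Relation.Binary.Equality using (≐-setoid)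

-- As usual for stdlib algebra, an algebra has a setoid carrier: the equality
-- of the algebra is _≈_, and all operations respect it.

record IsIdempotentSemiring {c ℓ} {S : Set c} (_≈_ : Rel S ℓ)
                            (_∨_ _·_ : Op₂ S) (e : S) : Set (c ⊔ ℓ) where
  field
    ·-isMonoid      : IsMonoid _≈_ _·_ e
    ∨-isSemilattice : IsSemilattice _≈_ _∨_
    distrib         : ∀ a b c d →
                      ((a · (b ∨ c)) · d) ≈ (((a · b) · d) ∨ ((a · c) · d))

  _≤_ : Rel S ℓ
  a ≤ b = (a ∨ b) ≈ b

-- Unlike in the stdlib IsIdempotentSemiring, 0 is only required
-- to be the least element, and annihilation by 0 is not an axiom.

record IsIdempotentZeroSemiring {c ℓ} {F : Set c} (_≈_ : Rel F ℓ)
                                (_∨_ _·_ : Op₂ F) (e 0# : F) : Set (c ⊔ ℓ) where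
  field
    isIdempotentSemiring : IsIdempotentSemiring _≈_ _∨_ _·_ e

  open IsIdempotentSemiring isIdempotentSemiring public

  field
    0#-least : Minimum _≤_ 0#

record IsIdempotentZeroSemifield {c ℓ} {F : Set c} (_≈_ : Rel F ℓ)
                                 (_∨_ _·_ : Op₂ F) (e 0# : F) : Set (c ⊔ ℓ) where
  field
    isIdempotentZeroSemiring : IsIdempotentZeroSemiring _≈_ _∨_ _·_ e 0#

  open IsIdempotentZeroSemiring isIdempotentZeroSemiring public

  F∖0 : Set (c ⊔ ℓ)
  F∖0 = ∃ λ a → ¬ (a ≈ 0#)

  -- The first two fields say that F∖0 is closed under the operations, so that
  -- ⟨F∖0, ·, e⟩ makes sense; in particular e and 0 are distinct.
  field
    e≉0      : ¬ (e ≈ 0#)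
    ·-closed : ∀ {a b} → ¬ (a ≈ 0#) → ¬ (b ≈ 0#) → ¬ ((a · b) ≈ 0#)

  _·∖0_ : Op₂ F∖0
  (a , a≉0) ·∖0 (b , b≉0) = (a · b) , ·-closed a≉0 b≉0

  e∖0 : F∖0
  e∖0 = e , e≉0

  field
    isGroupReduct : ∃ λ (_⁻¹ : Op₁ F∖0) → IsGroup (_≈_ on proj₁) _·∖0_ e∖0 _⁻¹

record IdempotentZeroSemifield c ℓ : Set (suc (c ⊔ ℓ)) where
  infixl 7 _·_
  infixl 6 _∨_
  infix  4 _≈_
  field
    Carrier : Set c
    _≈_     : Rel Carrier ℓ
    _∨_     : Op₂ Carrier
    _·_     : Op₂ Carrier
    e       : Carrier
    0#      : Carrier
    isIdempotentZeroSemifield : IsIdempotentZeroSemifield _≈_ _∨_ _·_ e 0#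

  open IsIdempotentZeroSemifield isIdempotentZeroSemifield public

  -- RawSemiring is used only as the type of lawless algebras in a signature
  -- with two binary operations and two constants; + is ∨, and 1 is e.
  raw : RawSemiring c ℓ
  raw = record
    { Carrier = Carrier
    ; _≈_     = _≈_
    ; _+_     = _∨_
    ; _*_     = _·_
    ; 0#      = 0#
    ; 1#      = e
    }

infixl 7 _·_
infixl 6 _∨_

data Term : Set where
  var     : ℕ → Term
  _∨_ _·_ : Term → Term → Term
  e 0#    : Term

termAlgebra : RawSemiring 0ℓ 0ℓ
termAlgebra = record
  { Carrier = Term
  ; _≈_     = _≡_
  ; _+_     = _∨_
  ; _*_     = _·_
  ; 0#      = 0#
  ; 1#      = e
  }

Equation : Set
Equation = Term × Term

infix 4 _⊨_

_⊨_ : ∀ {c ℓ} → IdempotentZeroSemifield c ℓ → Equation → Set (c ⊔ ℓ)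
A ⊨ (s , t) = ∀ (φ : Term → A.Carrier) →
              IsSemiringHomomorphism termAlgebra A.raw φ → φ s A.≈ φ t
  where module A = IdempotentZeroSemifield A

Class : ∀ c ℓ p → Set (suc (c ⊔ ℓ ⊔ p))
Class c ℓ p = Pred (IdempotentZeroSemifield c ℓ) p

Eq : ∀ {c ℓ p} → Class c ℓ p → Pred Equation (suc (c ⊔ ℓ) ⊔ p)
Eq K E = ∀ A → K A → A ⊨ E

-- The set { Eq(K) | K a class of idempotent 0-semifields }: its elements are
-- sets of equations, compared extensionally; the class K is not part of the
-- identity of an element.
EquationalTheories : ∀ c ℓ p → Setoid (suc (suc (c ⊔ ℓ) ⊔ p)) (suc (c ⊔ ℓ) ⊔ p)
EquationalTheories c ℓ p =
  On.setoid {B = ∃ λ (T : Pred Equation (suc (c ⊔ ℓ) ⊔ p)) →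
                 ∃ λ (K : Class c ℓ p) → T ≐ Eq K}
            (≐-setoid Equation (suc (c ⊔ ℓ) ⊔ p)) proj₁

{-# OPTIONS --safe #-}

-- Let A(q) be the group ℤ ⋉ ℚ in which 1 ∈ ℤ acts on ℚ by multiplication with
-- q > 1, ordered lexicographically, with a zero adjoined.  For x = (k , b) and
-- y = (0 , c) with c > 0, the inequalities yᵖx < xy < yʳx say p < qᵏ < r, and if
-- 1 < p ≤ r then they have no solutions of other shapes.  That they have no
-- solution in A(q) is expressed by an equation without inverses, because
-- "b ≤ a or d ≤ c" is equivalent to bd ≤ ad ∨ bc in every ordered group.
-- Taking for q the numbers qₙ = 4n + 6, none of which is a power of another, the
-- equation for p = qₙ - 1 and r = qₙ + 1 fails in A(qₘ) if and only if m = n.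
-- So distinct sets of indices n give distinct equational theories.

module Submission where

open import Defs
open import Algebra.Bundles using (CommutativeRing; Group)
open import Algebra.Core using (Op₁; Op₂)
import Algebra.Construct.NaturalChoice.Max as Max
import Algebra.Definitions.RawMonoid as RawMonoidOps
import Algebra.Definitions.RawSemiring as RawSemiringOps
open import Algebra.Morphism.Structures using (IsSemiringHomomorphism)
import Algebra.Properties.Semiring.Exp as Exp
import Algebra.Properties.Semiring.Mult as Mult
open import Algebra.Structures using (IsGroup)
open import Axiom.ExcludedMiddle using (ExcludedMiddle)
open import Data.Bool.Base using (Bool; true; false)
open import Data.Integer.Base as ℤ using (ℤ; +_; -[1+_]; _⊖_)
import Data.Integer.Properties as ℤ
open import Data.Nat.Base as ℕ using (ℕ; zero; suc)
open import Data.Nat.Divisibility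
  using (_∣_; _∣?_; *-pres-∣; ∣m+n∣m⇒∣n; ∣m∣n⇒∣m+n; m∣m*n; ∣-trans)
import Data.Nat.Properties as ℕ
open import Data.Product.Base as Product using (∃; _×_; _,_; proj₁; proj₂; uncurry)
open import Data.Product.Relation.Binary.Lex.Strict
  using (×-Lex; ×-transitive; ×-antisymmetric; ×-total₂; ×-decidable)
open import Data.Product.Relation.Binary.Pointwise.NonDependent using (≡×≡⇒≡)
open import Data.Rational.Base
  using (ℚ; 0ℚ; 1ℚ; _+_; _*_; _-_; -_; 1/_; _≤_; _<_; NonZero; Positive; NonNegative;
         nonNegative; nonPositive)
open import Data.Rational.Properties
  using (+-*-commutativeRing; nonNeg+nonNeg⇒nonNeg; pos+nonNeg⇒pos; pos*pos⇒pos; 1/pos⇒pos;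
         pos⇒nonZero; pos⇒nonNeg; nonNegative⁻¹; positive⁻¹; +-identityˡ; +-identityʳ;
         +-inverseˡ; +-inverseʳ; +-comm; *-identityˡ; *-identityʳ; *-inverseʳ; *-zeroˡ; *-zeroʳ;
         *-comm; +-monoʳ-≤; +-monoˡ-≤; +-monoˡ-<; +-mono-≤; *-monoˡ-≤-nonNeg; *-monoʳ-≤-nonPos;
         *-monoˡ-<-pos; *-cancelʳ-<-nonNeg; ≤-refl; ≤-reflexive; ≤-trans; ≤-antisym;
         ≤-total; _≤?_; <-trans; <⇒≤; <-irrefl; <-≤-trans; ≰⇒>; ≮⇒≥; module ≤-Reasoning)
open import Data.Rational.Solver using (module +-*-Solver)
open import Data.Sum.Base using (_⊎_; inj₁; inj₂)
open import Function.Base using (_∘_; id)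
open import Function.Bundles using (Bijection; Equivalence; Injection; _⇔_; mk⇔)
import Level
open import Level using (Level; 0ℓ; Lift; lift; lower)
open import Relation.Binary.Bundles using (Setoid; TotalOrder)
import Relation.Binary.Construct.Add.Infimum.NonStrict as AddInfimum
open import Relation.Binary.Core using (Rel; _Preserves₂_⟶_⟶_)
open import Relation.Binary.Definitions using (Decidable; tri<; tri≈; tri>)
open import Relation.Binary.PropositionalEquality
open import Relation.Binary.Structures using (IsTotalOrder)
open import Relation.Nullary.Construct.Add.Infimum using (_₋; ⊥₋; [_])
open import Relation.Nullary.Decidable
  using (Dec; yes; no; does; does-⇔; dec-true; decidable-stable; True; toWitness; fromWitness;
         from-no)
open import Relation.Nullary.Negation.Core using (¬_; contradiction)
open import Relation.Unary using (Pred)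

open RawSemiringOps termAlgebra using () renaming (_^_ to _^ᵗ_)
open Exp (CommutativeRing.semiring +-*-commutativeRing) using (_^_; ^-homo-*)
open Mult (CommutativeRing.semiring +-*-commutativeRing) using (×1-homo-*) renaming (_×_ to _×ℚ_)

-- The Cantor-Bernstein theorem for setoids, using excluded middle.

module CantorBernstein
  {a ℓa b ℓb : Level} {A : Setoid a ℓa} {B : Setoid b ℓb}
  (em : ∀ {ℓ} → ExcludedMiddle ℓ) (f : Injection A B) (g : Injection B A) where

  private
    module A = Setoid A
    module B = Setoid B
    module f = Injection f
    module g = Injection g

  Preimage : A.Carrier → Set _
  Preimage x = ∃ λ y → g.to y A.≈ x

  -- The points whose backward orbit under the two injections stops in A.
  data StopsInA (x : A.Carrier) : Set (a Level.⊔ ℓa Level.⊔ b) where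
    start : ¬ Preimage x → StopsInA x
    step  : ∀ {x′} → StopsInA x′ → g.to (f.to x′) A.≈ x → StopsInA x

  StopsInA-resp : ∀ {x y} → x A.≈ y → StopsInA x → StopsInA y
  StopsInA-resp x≈y (start ∄) = start λ (z , gz≈y) → ∄ (z , A.trans gz≈y (A.sym x≈y))
  StopsInA-resp x≈y (step s gfx′≈x) = step s (A.trans gfx′≈x x≈y)

  preimage : ∀ {x} → ¬ StopsInA x → Preimage x
  preimage ¬s = decidable-stable em (¬s ∘ start)

  to-helper : ∀ {x} → Dec (StopsInA x) → B.Carrier
  to-helper {x} (yes _) = f.to x
  to-helper     (no ¬s) = proj₁ (preimage ¬s)

  to : A.Carrier → B.Carrier
  to x = to-helper {x} em

  -- If the two agreed, applying `g` would give `g (f x) ≈ y`, so the orbit of `y` would stop in `A`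
  -- as well. This rules out collisions between the two branches of `to`.
  f[x]≉preimage : ∀ {x y} (s : StopsInA x) (¬s : ¬ StopsInA y) →
                  ¬ (f.to x B.≈ proj₁ (preimage ¬s))
  f[x]≉preimage s ¬s fx≈ = ¬s (step s (A.trans (g.cong fx≈) (proj₂ (preimage ¬s))))

  to-cong : ∀ {x y} → x A.≈ y → to x B.≈ to y
  to-cong {x} {y} x≈y with em {P = StopsInA x} | em {P = StopsInA y}
  ... | yes s | yes _ = f.cong x≈y
  ... | yes s | no ¬s = contradiction (StopsInA-resp x≈y s) ¬s
  ... | no ¬s | yes s = contradiction (StopsInA-resp (A.sym x≈y) s) ¬s
  ... | no ¬s | no ¬t = g.injective
    (A.trans (proj₂ (preimage ¬s)) (A.trans x≈y (A.sym (proj₂ (preimage ¬t)))))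

  injective : ∀ {x y} → to x B.≈ to y → x A.≈ y
  injective {x} {y} eq with em {P = StopsInA x} | em {P = StopsInA y}
  ... | yes s | yes _ = f.injective eq
  ... | yes s | no ¬s = contradiction eq (f[x]≉preimage s ¬s)
  ... | no ¬s | yes s = contradiction (B.sym eq) (f[x]≉preimage s ¬s)
  ... | no ¬s | no ¬t =
    A.trans (A.sym (proj₂ (preimage ¬s))) (A.trans (g.cong eq) (proj₂ (preimage ¬t)))

  to≈f : ∀ {x} → StopsInA x → to x B.≈ f.to x
  to≈f {x} s with em {P = StopsInA x}
  ... | yes _ = B.refl
  ... | no ¬s = contradiction s ¬s

  to-g≈id : ∀ {y} → ¬ StopsInA (g.to y) → to (g.to y) B.≈ y
  to-g≈id {y} ¬s with em {P = StopsInA (g.to y)}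
  ... | yes s = contradiction s ¬s
  ... | no ¬t = g.injective (proj₂ (preimage ¬t))

  -- The orbit of `g y` decides. If it does not stop in `A`, then `to` sends `g y` back to `y`. If
  -- it does, it cannot stop at `g y` itself, which has the preimage `y`, so `g y` is `g (f x)` for
  -- some `x` whose orbit stops in `A`.
  strictlySurjective : ∀ y → ∃ λ x → to x B.≈ y
  strictlySurjective y with em {P = StopsInA (g.to y)}
  ... | no ¬s = g.to y , to-g≈id ¬s
  ... | yes (start ∄) = contradiction (y , A.refl) ∄
  ... | yes (step {x} s gfx≈gy) = x , B.trans (to≈f s) (g.injective gfx≈gy)

  bijection : Bijection A B
  bijection = record
    { to        = to
    ; cong      = to-cong
    ; bijective = injective , λ y → let x , to[x]≈y = strictlySurjective y in
                                    x , λ z≈x → B.trans (to-cong z≈x) to[x]≈y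
    }

-- Injective coding of terms and equations by natural numbers.

-- pair m n = 2ᵐ(2n + 1)
pair : ℕ → ℕ → ℕ
pair zero    n = suc (2 ℕ.* n)
pair (suc m) n = 2 ℕ.* pair m n

-- Parity tells whether the exponent of 2 is zero, and factors of 2 are cancelled one at a time.
pair-injective : ∀ m m′ {n n′} → pair m n ≡ pair m′ n′ → m ≡ m′ × n ≡ n′
pair-injective zero    zero     eq = refl , ℕ.*-cancelˡ-≡ _ _ 2 (ℕ.suc-injective eq)
pair-injective zero    (suc m′) {n} {n′} eq = contradiction (sym eq) (ℕ.even≢odd (pair m′ n′) n)
pair-injective (suc m) zero     {n} {n′} eq = contradiction eq (ℕ.even≢odd (pair m n) n′)
pair-injective (suc m) (suc m′) eq =
  Product.map (cong suc) id (pair-injective m m′ (ℕ.*-cancelˡ-≡ _ _ 2 eq))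

tag body encode : Term → ℕ

tag (var _) = 0
tag (_ ∨ _) = 1
tag (_ · _) = 2
tag e       = 3
tag 0#      = 4

body (var n) = n
body (s ∨ t) = pair (encode s) (encode t)
body (s · t) = pair (encode s) (encode t)
body e       = 0
body 0#      = 0

encode t = pair (tag t) (body t)

encode-injective : ∀ s t → encode s ≡ encode t → s ≡ t
tag-body-injective : ∀ s t → tag s ≡ tag t → body s ≡ body t → s ≡ t

encode-injective s t eq = uncurry (tag-body-injective s t)
  (pair-injective (tag s) (tag t) eq)

-- Different head constructors have different numerals as tags, so only the diagonal cases remain.
tag-body-injective (var _) (var _)   _ eq = cong var eq
tag-body-injective (s ∨ t) (s′ ∨ t′) _ eq =
  let p , q = pair-injective (encode s) (encode s′) eq in
  cong₂ _∨_ (encode-injective s s′ p) (encode-injective t t′ q)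
tag-body-injective (s · t) (s′ · t′) _ eq =
  let p , q = pair-injective (encode s) (encode s′) eq in
  cong₂ _·_ (encode-injective s s′ p) (encode-injective t t′ q)
tag-body-injective e       e         _ _ = refl
tag-body-injective 0#      0#        _ _ = refl

encodeEquation : Equation → ℕ
encodeEquation (s , t) = pair (encode s) (encode t)

encodeEquation-injective : ∀ {E E′} → encodeEquation E ≡ encodeEquation E′ → E ≡ E′
encodeEquation-injective {s , t} {s′ , t′} eq =
  let p , q = pair-injective (encode s) (encode s′) eq in
  cong₂ _,_ (encode-injective s s′ p) (encode-injective t t′ q)

-- The separating equations.

xy : Term
xy = var 0 · var 1

y^_x : ℕ → Term
y^ n x = var 1 ^ᵗ n · var 0

-- In a totally ordered group this equation says that no x and y satisfy
-- yᵖx < xy < yʳx, since bd ≤ ad ∨ bc holds if and only if b ≤ a or d ≤ c.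
noneBetween : ℕ → ℕ → Equation
noneBetween p r = xy · y^ r x ∨ (y^ p x · y^ r x ∨ xy · xy) , y^ p x · y^ r x ∨ xy · xy

-- Totally ordered groups with a zero adjoined.

module AdjoinZero
  {G : Set} {_∙_ : Op₂ G} {ε : G} {_⁻¹ : Op₁ G} {_≤_ : Rel G 0ℓ}
  (isGroup : IsGroup _≡_ _∙_ ε _⁻¹)
  (isTotalOrder : IsTotalOrder _≡_ _≤_)
  (∙-mono-≤ : _∙_ Preserves₂ _≤_ ⟶ _≤_ ⟶ _≤_)
  where

  private
    group : Group 0ℓ 0ℓ
    group = record { isGroup = isGroup }

    module G where
      open IsGroup isGroup public
      open IsTotalOrder isTotalOrder public using () renaming (refl to ≤-refl)
      open RawMonoidOps (Group.rawMonoid group) public using (_×_)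

  open AddInfimum _≤_

  totalOrder : TotalOrder _ _ _
  totalOrder = record { isTotalOrder = ≤₋-isTotalOrder-≡ isTotalOrder }

  open Max totalOrder
  private module ≤₋ = TotalOrder totalOrder

  infixl 7 _∙₋_
  _∙₋_ : Op₂ (G ₋)
  ⊥₋    ∙₋ _     = ⊥₋
  [ _ ] ∙₋ ⊥₋    = ⊥₋
  [ x ] ∙₋ [ y ] = [ x ∙ y ]

  ∙₋-assoc : ∀ x y z → (x ∙₋ y) ∙₋ z ≡ x ∙₋ (y ∙₋ z)
  ∙₋-assoc ⊥₋    _     _     = refl
  ∙₋-assoc [ _ ] ⊥₋    _     = refl
  ∙₋-assoc [ _ ] [ _ ] ⊥₋    = refl
  ∙₋-assoc [ x ] [ y ] [ z ] = cong [_] (G.assoc x y z)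

  ∙₋-identityˡ : ∀ x → [ ε ] ∙₋ x ≡ x
  ∙₋-identityˡ ⊥₋    = refl
  ∙₋-identityˡ [ x ] = cong [_] (G.identityˡ x)

  ∙₋-identityʳ : ∀ x → x ∙₋ [ ε ] ≡ x
  ∙₋-identityʳ ⊥₋    = refl
  ∙₋-identityʳ [ x ] = cong [_] (G.identityʳ x)

  ∙₋-mono-≤₋ : _∙₋_ Preserves₂ _≤₋_ ⟶ _≤₋_ ⟶ _≤₋_
  ∙₋-mono-≤₋ (⊥₋≤ _)         _       = ⊥₋≤ _
  ∙₋-mono-≤₋ {[ _ ]} [ _ ]   (⊥₋≤ _) = ⊥₋≤ _
  ∙₋-mono-≤₋ [ x≤x′ ] [ y≤y′ ]       = [ ∙-mono-≤ x≤x′ y≤y′ ]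

  -- The join of a chain is a maximum, which every monotone map preserves, in particular two-sided
  -- multiplication.
  ∙₋-distrib-⊔ : ∀ x y z w → (x ∙₋ (y ⊔ z)) ∙₋ w ≡ (x ∙₋ y) ∙₋ w ⊔ (x ∙₋ z) ∙₋ w
  ∙₋-distrib-⊔ x y z w = mono-≤-distrib-⊔ {f = λ u → (x ∙₋ u) ∙₋ w}
    (cong λ u → (x ∙₋ u) ∙₋ w)
    (λ u≤v → ∙₋-mono-≤₋ (∙₋-mono-≤₋ (≤₋.refl {x}) u≤v) (≤₋.refl {w})) y z

  -- Carrier and equality are lifted so that the same algebra is available at all levels.
  semifield : ∀ c ℓ → IdempotentZeroSemifield c ℓ
  semifield c ℓ = record
    { Carrier = Carrier
    ; _≈_ = _≈_
    ; _∨_ = λ x y → lift (lower x ⊔ lower y)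
    ; _·_ = _·₀_
    ; e = lift [ ε ]
    ; 0# = 0ᶠ
    ; isIdempotentZeroSemifield = record
      { isIdempotentZeroSemiring = record
        { isIdempotentSemiring = record
          { ·-isMonoid = record
            { isSemigroup = record
              { isMagma = record
                { isEquivalence = ≈-isEquivalence
                ; ∙-cong = λ p q → lift (cong₂ _∙₋_ (lower p) (lower q))
                }
              ; assoc = λ x y z → lift (∙₋-assoc (lower x) (lower y) (lower z))
              }
            ; identity = (λ x → lift (∙₋-identityˡ (lower x))) ,
                         (λ x → lift (∙₋-identityʳ (lower x)))
            }
          ; ∨-isSemilattice = record
            { isBand = record
              { isSemigroup = record
                { isMagma = record
                  { isEquivalence = ≈-isEquivalence
                  ; ∙-cong = λ p q → lift (cong₂ _⊔_ (lower p) (lower q))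
                  }
                ; assoc = λ x y z → lift (⊔-assoc (lower x) (lower y) (lower z))
                }
              ; idem = λ x → lift (⊔-idem (lower x))
              }
            ; comm = λ x y → lift (⊔-comm (lower x) (lower y))
            }
          ; distrib = λ x y z w → lift (∙₋-distrib-⊔ (lower x) (lower y) (lower z) (lower w))
          }
        ; 0#-least = λ x → lift (x≤y⇒x⊔y≈y (⊥₋≤ (lower x)))
        }
      ; e≉0 = λ ()
      ; ·-closed = λ {x} {y} → ·₀-closed x y
      ; isGroupReduct = inv , record
        { isMonoid = record
          { isSemigroup = record
            { isMagma = record
              { isEquivalence = record
                { refl = lift refl
                ; sym = λ p → lift (sym (lower p))
                ; trans = λ p q → lift (trans (lower p) (lower q))
                }
              ; ∙-cong = λ p q → lift (cong₂ _∙₋_ (lower p) (lower q))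
              }
            ; assoc = λ x y z → lift (∙₋-assoc (lower (proj₁ x)) (lower (proj₁ y)) (lower (proj₁ z)))
            }
          ; identity = (λ x → lift (∙₋-identityˡ (lower (proj₁ x)))) ,
                       (λ x → lift (∙₋-identityʳ (lower (proj₁ x))))
          }
        ; inverse = inverseˡ , inverseʳ
        ; ⁻¹-cong = λ {x} {y} → inv-cong x y
        }
      }
    }
    where
    Carrier : Set c
    Carrier = Lift c (G ₋)

    _≈_ : Rel Carrier ℓ
    x ≈ y = Lift ℓ (lower x ≡ lower y)

    ≈-isEquivalence = record
      { refl = lift refl
      ; sym = λ p → lift (sym (lower p))
      ; trans = λ p q → lift (trans (lower p) (lower q))
      }

    _·₀_ : Op₂ Carrier
    x ·₀ y = lift (lower x ∙₋ lower y)

    0ᶠ : Carrier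
    0ᶠ = lift ⊥₋

    ·₀-closed : ∀ x y → ¬ x ≈ 0ᶠ → ¬ y ≈ 0ᶠ → ¬ (x ·₀ y) ≈ 0ᶠ
    ·₀-closed (lift ⊥₋)    _            x≉0 _   _ = x≉0 (lift refl)
    ·₀-closed (lift [ _ ]) (lift ⊥₋)    _   y≉0 _ = y≉0 (lift refl)
    ·₀-closed (lift [ _ ]) (lift [ _ ]) _   _   ()

    inv : Op₁ (∃ λ x → ¬ x ≈ 0ᶠ)
    inv (lift ⊥₋    , x≉0) = contradiction (lift refl) x≉0
    inv (lift [ x ] , _)   = lift [ x ⁻¹ ] , λ ()

    inverseˡ : ∀ x → (proj₁ (inv x) ·₀ proj₁ x) ≈ lift [ ε ]
    inverseˡ (lift ⊥₋    , x≉0) = contradiction (lift refl) x≉0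
    inverseˡ (lift [ x ] , _)   = lift (cong [_] (G.inverseˡ x))

    inverseʳ : ∀ x → (proj₁ x ·₀ proj₁ (inv x)) ≈ lift [ ε ]
    inverseʳ (lift ⊥₋    , x≉0) = contradiction (lift refl) x≉0
    inverseʳ (lift [ x ] , _)   = lift (cong [_] (G.inverseʳ x))

    inv-cong : ∀ x y → proj₁ x ≈ proj₁ y → proj₁ (inv x) ≈ proj₁ (inv y)
    inv-cong (lift ⊥₋    , x≉0) _                    _           = contradiction (lift refl) x≉0
    inv-cong (lift [ _ ] , _)   (lift ⊥₋    , y≉0)   _           = contradiction (lift refl) y≉0
    inv-cong (lift [ x ] , _)   (lift [ .x ] , _)    (lift refl) = lift refl

  ⟦_⟧ : Term → (ℕ → G ₋) → G ₋
  ⟦ var n ⟧ ρ = ρ n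
  ⟦ s ∨ t ⟧ ρ = ⟦ s ⟧ ρ ⊔ ⟦ t ⟧ ρ
  ⟦ s · t ⟧ ρ = ⟦ s ⟧ ρ ∙₋ ⟦ t ⟧ ρ
  ⟦ e ⟧     ρ = [ ε ]
  ⟦ 0# ⟧    ρ = ⊥₋

  module _ {c ℓ : Level} where

    open IdempotentZeroSemifield (semifield c ℓ) using (Carrier; raw)

    -- The term algebra is free on the variables, so homomorphisms are the same as valuations `ρ`;
    -- this reduces satisfaction to evaluation.
    homomorphism≗⟦⟧ : ∀ {φ : Term → Carrier} → IsSemiringHomomorphism termAlgebra raw φ →
                      ∀ t → lower (φ t) ≡ ⟦ t ⟧ (lower ∘ φ ∘ var)
    homomorphism≗⟦⟧ {φ} φ-homo = go
      where
      open IsSemiringHomomorphism φ-homo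
      go : ∀ t → lower (φ t) ≡ ⟦ t ⟧ (lower ∘ φ ∘ var)
      go (var _) = refl
      go (s ∨ t) = trans (lower (+-homo s t)) (cong₂ _⊔_ (go s) (go t))
      go (s · t) = trans (lower (*-homo s t)) (cong₂ _∙₋_ (go s) (go t))
      go e       = lower 1#-homo
      go 0#      = lower 0#-homo

    ⟦⟧-isSemiringHomomorphism : ∀ ρ → IsSemiringHomomorphism termAlgebra raw (λ t → lift (⟦ t ⟧ ρ))
    ⟦⟧-isSemiringHomomorphism ρ = record
      { isNearSemiringHomomorphism = record
        { +-isMonoidHomomorphism = record
          { isMagmaHomomorphism = record
            { isRelHomomorphism = record { cong = λ s≡t → lift (cong (λ t → ⟦ t ⟧ ρ) s≡t) }
            ; homo = λ _ _ → lift refl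
            }
          ; ε-homo = lift refl
          }
        ; *-homo = λ _ _ → lift refl
        }
      ; 1#-homo = lift refl
      }

    ⊨⇔ : ∀ E → semifield c ℓ ⊨ E ⇔ (∀ ρ → ⟦ proj₁ E ⟧ ρ ≡ ⟦ proj₂ E ⟧ ρ)
    ⊨⇔ (s , t) = mk⇔
      (λ ⊨s≈t ρ → lower (⊨s≈t _ (⟦⟧-isSemiringHomomorphism ρ)))
      (λ s≗t φ φ-homo → lift (trans (homomorphism≗⟦⟧ φ-homo s)
                        (trans (s≗t _) (sym (homomorphism≗⟦⟧ φ-homo t)))))

  ⟦^⟧ : ∀ t n {ρ x} → ⟦ t ⟧ ρ ≡ [ x ] → ⟦ t ^ᵗ n ⟧ ρ ≡ [ n G.× x ]
  ⟦^⟧ t zero    eq = refl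
  ⟦^⟧ t (suc n) eq rewrite eq | ⟦^⟧ t n eq = refl

  ∙-cancelʳ-≤ : ∀ z {x y} → (x ∙ z) ≤ (y ∙ z) → x ≤ y
  ∙-cancelʳ-≤ z {x} {y} xz≤yz = subst₂ _≤_ (xzz⁻¹≡x x) (xzz⁻¹≡x y) (∙-mono-≤ xz≤yz G.≤-refl)
    where
    xzz⁻¹≡x : ∀ w → ((w ∙ z) ∙ (z ⁻¹)) ≡ w
    xzz⁻¹≡x w = trans (G.assoc w z (z ⁻¹)) (trans (cong (w ∙_) (G.inverseʳ z)) (G.identityʳ w))

  ∙-cancelˡ-≤ : ∀ z {x y} → (z ∙ x) ≤ (z ∙ y) → x ≤ y
  ∙-cancelˡ-≤ z {x} {y} zx≤zy = subst₂ _≤_ (z⁻¹zx≡x x) (z⁻¹zx≡x y) (∙-mono-≤ G.≤-refl zx≤zy)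
    where
    z⁻¹zx≡x : ∀ w → ((z ⁻¹) ∙ (z ∙ w)) ≡ w
    z⁻¹zx≡x w = trans (sym (G.assoc (z ⁻¹) z w)) (trans (cong (_∙ w) (G.inverseˡ z)) (G.identityˡ w))

  module _ {a b c d : G} where
    -- In a chain the join is one of its two arguments; cancelling `d` on the right or `b` on the
    -- left gives the corresponding alternative.
    product≤⇒ : [ b ∙ d ] ≤₋ [ a ∙ d ] ⊔ [ b ∙ c ] → b ≤ a ⊎ d ≤ c
    product≤⇒ bd≤ with ⊔-sel [ a ∙ d ] [ b ∙ c ]
    ... | inj₁ eq = inj₁ (∙-cancelʳ-≤ d ([≤]-injective (subst ([ b ∙ d ] ≤₋_) eq bd≤)))
    ... | inj₂ eq = inj₂ (∙-cancelˡ-≤ b ([≤]-injective (subst ([ b ∙ d ] ≤₋_) eq bd≤)))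

    product≤⇐ : b ≤ a ⊎ d ≤ c → [ b ∙ d ] ≤₋ [ a ∙ d ] ⊔ [ b ∙ c ]
    product≤⇐ (inj₁ b≤a) = x≤y⇒x≤y⊔z [ b ∙ c ] [ ∙-mono-≤ b≤a G.≤-refl ]
    product≤⇐ (inj₂ d≤c) = x≤y⇒x≤z⊔y [ a ∙ d ] [ ∙-mono-≤ G.≤-refl d≤c ]

  ⟦y^x⟧ : ∀ {ρ x y} n → ρ 0 ≡ [ x ] → ρ 1 ≡ [ y ] → ⟦ y^ n x ⟧ ρ ≡ [ (n G.× y) ∙ x ]
  ⟦y^x⟧ n ρ0≡x ρ1≡y = cong₂ _∙₋_ (⟦^⟧ (var 1) n ρ1≡y) ρ0≡x

  module _ {c ℓ : Level} (p r : ℕ) where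

    NoneBetween : Set
    NoneBetween = ∀ x y → (x ∙ y) ≤ ((p G.× y) ∙ x) ⊎ ((r G.× y) ∙ x) ≤ (x ∙ y)

    -- This is `product≤⇒` for a = yᵖx, b = c = xy and d = yʳx.
    ⊨noneBetween⇒ : semifield c ℓ ⊨ noneBetween p r → NoneBetween
    ⊨noneBetween⇒ holds x y = product≤⇒
      (subst₂ (λ u v → [ x ∙ y ] ∙₋ v ≤₋ u ∙₋ v ⊔ [ x ∙ y ] ∙₋ [ x ∙ y ])
        (⟦y^x⟧ {ρ} p refl refl) (⟦y^x⟧ {ρ} r refl refl)
        (x⊔y≈y⇒x≤y (Equivalence.to (⊨⇔ (noneBetween p r)) holds ρ)))
      where
      ρ : ℕ → G ₋
      ρ 0 = [ x ]
      ρ _ = [ y ]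

    ⊨noneBetween⇐ : NoneBetween → semifield c ℓ ⊨ noneBetween p r
    ⊨noneBetween⇐ none = Equivalence.from (⊨⇔ (noneBetween p r))
      λ ρ → x≤y⇒x⊔y≈y (bd≤ ρ (ρ 0) (ρ 1) refl refl)
      where
      bd≤ : ∀ ρ x y → ρ 0 ≡ x → ρ 1 ≡ y →
            ⟦ xy · y^ r x ⟧ ρ ≤₋ ⟦ y^ p x · y^ r x ∨ xy · xy ⟧ ρ
      -- If x or y is 0, then so is xy, and with it the whole left-hand product.
      bd≤ ρ ⊥₋    _     eq₀ _   rewrite eq₀       = ⊥₋≤ _
      bd≤ ρ [ _ ] ⊥₋    eq₀ eq₁ rewrite eq₀ | eq₁ = ⊥₋≤ _
      bd≤ ρ [ x ] [ y ] eq₀ eq₁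
        rewrite ⟦y^x⟧ {ρ} p eq₀ eq₁ | ⟦y^x⟧ {ρ} r eq₀ eq₁ | eq₀ | eq₁ = product≤⇐ (none x y)

-- Natural numbers inside the rationals.

fromℕ : ℕ → ℚ
fromℕ n = n ×ℚ 1ℚ

fromℕ-nonNegative : ∀ n → NonNegative (fromℕ n)
fromℕ-nonNegative zero    = _
fromℕ-nonNegative (suc n) = nonNeg+nonNeg⇒nonNeg 1ℚ (fromℕ n) {{fromℕ-nonNegative n}}

fromℕ-positive : ∀ n .{{_ : ℕ.NonZero n}} → Positive (fromℕ n)
fromℕ-positive (suc n) = pos+nonNeg⇒pos 1ℚ (fromℕ n) {{fromℕ-nonNegative n}}

fromℕ-mono-≤ : ∀ {m n} → m ℕ.≤ n → fromℕ m ≤ fromℕ n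
fromℕ-mono-≤ {n = n} ℕ.z≤n = nonNegative⁻¹ (fromℕ n) {{fromℕ-nonNegative n}}
fromℕ-mono-≤ (ℕ.s≤s m≤n)   = +-monoʳ-≤ 1ℚ (fromℕ-mono-≤ m≤n)

fromℕ-cancel-< : ∀ {m n} → fromℕ m < fromℕ n → m ℕ.< n
fromℕ-cancel-< m<n = ℕ.≰⇒> λ n≤m → <-irrefl refl (<-≤-trans m<n (fromℕ-mono-≤ n≤m))

fromℕ-mono-< : ∀ {m n} → m ℕ.< n → fromℕ m < fromℕ n
fromℕ-mono-< {m} m<n = <-≤-trans m<1+m (fromℕ-mono-≤ m<n)
  where
  m<1+m : fromℕ m < fromℕ (suc m)
  m<1+m = subst (_< fromℕ (suc m)) (+-identityˡ (fromℕ m)) (+-monoˡ-< (fromℕ m) (positive⁻¹ 1ℚ))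

fromℕ-homo-^ : ∀ m n → fromℕ (m ℕ.^ n) ≡ fromℕ m ^ n
fromℕ-homo-^ m zero    = +-identityʳ 1ℚ
fromℕ-homo-^ m (suc n) = trans (×1-homo-* m (m ℕ.^ n)) (cong (fromℕ m *_) (fromℕ-homo-^ m n))

^-positive : ∀ p .{{_ : Positive p}} n → Positive (p ^ n)
^-positive p zero    = _
^-positive p (suc n) = pos*pos⇒pos p (p ^ n) {{^-positive p n}}

-- The lexicographically ordered group ℤ ⋉ ℚ.

-- ℤ ⋉ ℚ, where 1 ∈ ℤ acts on ℚ by multiplication with q.
module AffineGroup (q : ℚ) .{{q>0 : Positive q}} where

  private
    instance
      q≢0 : NonZero q
      q≢0 = pos⇒nonZero q

  infixr 8 q^_
  q^_ : ℤ → ℚ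
  q^ (+ n)    = q ^ n
  q^ -[1+ n ] = (1/ q) ^ suc n

  q^-positive : ∀ k → Positive (q^ k)
  q^-positive (+ n)    = ^-positive q n
  q^-positive -[1+ n ] = ^-positive (1/ q) {{1/pos⇒pos q}} (suc n)

  -- `_⊖_` cancels successors in pairs; on the right this matches a factor `q * (1/ q) = 1`.
  q^[m⊖n] : ∀ m n → q^ (m ⊖ n) ≡ q ^ m * (1/ q) ^ n
  q^[m⊖n] m       zero    = sym (*-identityʳ (q ^ m))
  q^[m⊖n] zero    (suc n) = sym (*-identityˡ ((1/ q) ^ suc n))
  q^[m⊖n] (suc m) (suc n) = begin
    q^ (suc m ⊖ suc n)                  ≡⟨ cong q^_ (ℤ.[1+m]⊖[1+n]≡m⊖n m n) ⟩
    q^ (m ⊖ n)                          ≡⟨ q^[m⊖n] m n ⟩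
    q ^ m * (1/ q) ^ n                  ≡⟨ *-identityˡ _ ⟨
    1ℚ * (q ^ m * (1/ q) ^ n)           ≡⟨ cong (λ u → u * (q ^ m * (1/ q) ^ n)) (*-inverseʳ q) ⟨
    q * (1/ q) * (q ^ m * (1/ q) ^ n)   ≡⟨ solve 4 (λ a b c d → (a :* b) :* (c :* d) := (a :* c) :* (b :* d))
                                                  refl q (1/ q) (q ^ m) ((1/ q) ^ n) ⟩
    q ^ suc m * (1/ q) ^ suc n          ∎
    where
    open ≡-Reasoning
    open +-*-Solver

  q^-homo-+ : ∀ k l → q^ (k ℤ.+ l) ≡ q^ k * q^ l
  q^-homo-+ (+ m)    (+ n)    = ^-homo-* q m n
  q^-homo-+ (+ m)    -[1+ n ] = q^[m⊖n] m (suc n)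
  q^-homo-+ -[1+ m ] (+ n)    = trans (q^[m⊖n] n (suc m)) (*-comm (q ^ n) _)
  q^-homo-+ -[1+ m ] -[1+ n ] =
    trans (cong (λ k → (1/ q) ^ suc k) (sym (ℕ.+-suc m n))) (^-homo-* (1/ q) (suc m) (suc n))

  G : Set
  G = ℤ × ℚ

  infixl 7 _∙_
  -- The pair (k , b) acts on ℚ as the affine map sending t to b + qᵏt, and products act by
  -- composition.
  _∙_ : Op₂ G
  (k , b) ∙ (l , c) = k ℤ.+ l , b + q^ k * c

  ε : G
  ε = ℤ.0ℤ , 0ℚ

  infix 9 _⁻¹
  _⁻¹ : Op₁ G
  (k , b) ⁻¹ = ℤ.- k , - (q^ (ℤ.- k) * b)

  ∙-assoc : ∀ x y z → (x ∙ y) ∙ z ≡ x ∙ (y ∙ z)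
  ∙-assoc (k , b) (l , c) (m , d) = cong₂ _,_ (ℤ.+-assoc k l m) (begin
    b + q^ k * c + q^ (k ℤ.+ l) * d     ≡⟨ cong (λ u → b + q^ k * c + u * d) (q^-homo-+ k l) ⟩
    b + q^ k * c + (q^ k * q^ l) * d    ≡⟨ solve 5 (λ b u c v d → b :+ u :* c :+ (u :* v) :* d :=
                                                      b :+ u :* (c :+ v :* d))
                                                  refl b (q^ k) c (q^ l) d ⟩
    b + q^ k * (c + q^ l * d)           ∎)
    where
    open ≡-Reasoning
    open +-*-Solver

  ∙-identityˡ : ∀ x → ε ∙ x ≡ x
  ∙-identityˡ (k , b) = cong₂ _,_ (ℤ.+-identityˡ k) (trans (+-identityˡ _) (*-identityˡ b))

  ∙-identityʳ : ∀ x → x ∙ ε ≡ x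
  ∙-identityʳ (k , b) =
    cong₂ _,_ (ℤ.+-identityʳ k) (trans (cong (λ u → b + u) (*-zeroʳ (q^ k))) (+-identityʳ b))

  ∙-inverseˡ : ∀ x → x ⁻¹ ∙ x ≡ ε
  ∙-inverseˡ (k , b) = cong₂ _,_ (ℤ.+-inverseˡ k) (+-inverseˡ (q^ (ℤ.- k) * b))

  ∙-inverseʳ : ∀ x → x ∙ x ⁻¹ ≡ ε
  ∙-inverseʳ (k , b) = cong₂ _,_ (ℤ.+-inverseʳ k) (begin
    b + q^ k * - (q^ (ℤ.- k) * b)   ≡⟨ solve 3 (λ b u v → b :+ u :* :- (v :* b) := b :+ :- ((u :* v) :* b))
                                              refl b (q^ k) (q^ (ℤ.- k)) ⟩
    b - q^ k * q^ (ℤ.- k) * b       ≡⟨ cong (λ u → b - u * b) (q^-homo-+ k (ℤ.- k)) ⟨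
    b - q^ (k ℤ.- k) * b            ≡⟨ cong (λ l → b - q^ l * b) (ℤ.+-inverseʳ k) ⟩
    b - 1ℚ * b                      ≡⟨ cong (λ u → b - u) (*-identityˡ b) ⟩
    b - b                           ≡⟨ +-inverseʳ b ⟩
    0ℚ                              ∎)
    where
    open ≡-Reasoning
    open +-*-Solver

  isGroup : IsGroup _≡_ _∙_ ε _⁻¹
  isGroup = record
    { isMonoid = record
      { isSemigroup = record
        { isMagma = isMagma _∙_
        ; assoc   = ∙-assoc
        }
      ; identity = ∙-identityˡ , ∙-identityʳ
      }
    ; inverse = ∙-inverseˡ , ∙-inverseʳ
    ; ⁻¹-cong = cong _⁻¹
    }

  infix 4 _≤ᴳ_ _<ᴳ_
  _≤ᴳ_ _<ᴳ_ : Rel G 0ℓ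
  _≤ᴳ_ = ×-Lex _≡_ ℤ._<_ _≤_
  _<ᴳ_ = ×-Lex _≡_ ℤ._<_ _<_

  ≤ᴳ-isTotalOrder : IsTotalOrder _≡_ _≤ᴳ_
  ≤ᴳ-isTotalOrder = record
    { isPartialOrder = record
      { isPreorder = record
        { isEquivalence = isEquivalence
        ; reflexive     = λ { refl → inj₂ (refl , ≤-refl) }
        ; trans         = ×-transitive {_<₂_ = _≤_} isEquivalence
                            (resp₂ ℤ._<_) ℤ.<-trans ≤-trans
        }
      ; antisym = λ x≤y y≤x → ≡×≡⇒≡
          (×-antisymmetric {_≈₁_ = _≡_} {_<₁_ = ℤ._<_} {_≈₂_ = _≡_} {_<₂_ = _≤_}
            sym ℤ.<-irrefl ℤ.<-asym ≤-antisym x≤y y≤x)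
      }
    ; total = ×-total₂ sym ℤ.<-cmp ≤-total
    }

  -- The factor qᵏ is positive, so scaling by it keeps the order of second components; the rest is
  -- monotonicity of addition.
  ∙-mono-≤ᴳ : _∙_ Preserves₂ _≤ᴳ_ ⟶ _≤ᴳ_ ⟶ _≤ᴳ_
  ∙-mono-≤ᴳ (inj₁ k<k′)          (inj₁ l<l′)          = inj₁ (ℤ.+-mono-< k<k′ l<l′)
  ∙-mono-≤ᴳ (inj₁ k<k′)          (inj₂ (refl , _))    = inj₁ (ℤ.+-monoˡ-< _ k<k′)
  ∙-mono-≤ᴳ {k , _} (inj₂ (refl , _)) (inj₁ l<l′) = inj₁ (ℤ.+-monoʳ-< k l<l′)
  ∙-mono-≤ᴳ {k , _} (inj₂ (refl , b≤b′)) (inj₂ (refl , c≤c′)) = inj₂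
    (refl , +-mono-≤ b≤b′
      (*-monoˡ-≤-nonNeg (q^ k) {{pos⇒nonNeg (q^ k) {{q^-positive k}}}} c≤c′))

  ≰ᴳ⇒> : ∀ {x y} → ¬ x ≤ᴳ y → y <ᴳ x
  ≰ᴳ⇒> {k , b} {l , c} x≰y with ℤ.<-cmp k l
  ... | tri< k<l _ _  = contradiction (inj₁ k<l) x≰y
  ... | tri≈ _ refl _ = inj₂ (refl , ≰⇒> λ b≤c → x≰y (inj₂ (refl , b≤c)))
  ... | tri> _ _ l<k  = inj₁ l<k

  <ᴳ⇒≱ : ∀ {x y} → x <ᴳ y → ¬ y ≤ᴳ x
  <ᴳ⇒≱ (inj₁ k<l)          (inj₁ l<k)       = ℤ.<-asym k<l l<k
  <ᴳ⇒≱ (inj₁ k<l)          (inj₂ (l≡k , _)) = ℤ.<-irrefl (sym l≡k) k<l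
  <ᴳ⇒≱ (inj₂ (k≡l , _))    (inj₁ l<k)       = ℤ.<-irrefl (sym k≡l) l<k
  <ᴳ⇒≱ (inj₂ (_ , b<c))    (inj₂ (_ , c≤b)) = <-irrefl refl (<-≤-trans b<c c≤b)

  group : Group 0ℓ 0ℓ
  group = record { isGroup = isGroup }

  open RawMonoidOps (Group.rawMonoid group) public using () renaming (_×_ to _×ᴳ_)

  proj₁-× : ∀ n x → proj₁ (n ×ᴳ x) ≡ + n ℤ.* proj₁ x
  proj₁-× zero    x = sym (ℤ.*-zeroˡ (proj₁ x))
  proj₁-× (suc n) x = trans (cong (ℤ._+_ (proj₁ x)) (proj₁-× n x)) (sym (ℤ.suc-* (+ n) (proj₁ x)))

  ×-base : ∀ n c → n ×ᴳ (ℤ.0ℤ , c) ≡ (ℤ.0ℤ , fromℕ n * c)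
  ×-base zero    c = cong (ℤ.0ℤ ,_) (sym (*-zeroˡ c))
  ×-base (suc n) c rewrite ×-base n c = cong (ℤ.0ℤ ,_)
    (solve 2 (λ c u → c :+ con 1ℚ :* (u :* c) := (con 1ℚ :+ u) :* c) refl c (fromℕ n))
    where open +-*-Solver

  <ᴳ⇒proj₁-≤ : ∀ {x y} → x <ᴳ y → proj₁ x ℤ.≤ proj₁ y
  <ᴳ⇒proj₁-≤ (inj₁ k<l)       = ℤ.<⇒≤ k<l
  <ᴳ⇒proj₁-≤ (inj₂ (k≡l , _)) = ℤ.≤-reflexive k≡l

  <ᴳ⇒proj₂-< : ∀ {k b c} → (k , b) <ᴳ (k , c) → b < c
  <ᴳ⇒proj₂-< (inj₁ k<k)       = contradiction k<k (ℤ.<-irrefl refl)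
  <ᴳ⇒proj₂-< (inj₂ (_ , b<c)) = b<c

  -- For l > 0 the first bound fails since pl > l, and for l < 0 the second fails since rl < l.
  -- Applied to ℤ-components, this forces `y` into the subgroup ℚ.
  squeezed⇒≡0 : ∀ {p r} k l → 1 ℕ.< p → 1 ℕ.< r →
                + p ℤ.* l ℤ.+ k ℤ.≤ k ℤ.+ l → k ℤ.+ l ℤ.≤ + r ℤ.* l ℤ.+ k → l ≡ ℤ.0ℤ
  squeezed⇒≡0 k (+ zero) _ _ _ _ = refl
  squeezed⇒≡0 {p} {r} k l@(ℤ.+[1+ _ ]) 1<p 1<r pl+k≤k+l _ =
    contradiction pl+k≤k+l (ℤ.<⇒≱ (begin-strict
    k ℤ.+ l             ≡⟨ ℤ.+-comm k l ⟩
    l ℤ.+ k             ≡⟨ cong (ℤ._+ k) (ℤ.*-identityˡ l) ⟨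
    + 1 ℤ.* l ℤ.+ k     <⟨ ℤ.+-monoˡ-< k (ℤ.*-monoʳ-<-pos l (ℤ.+<+ 1<p)) ⟩
    + p ℤ.* l ℤ.+ k     ∎))
    where open ℤ.≤-Reasoning
  squeezed⇒≡0 {p} {r} k l@(-[1+ _ ]) 1<p 1<r _ k+l≤rl+k =
    contradiction k+l≤rl+k (ℤ.<⇒≱ (begin-strict
    + r ℤ.* l ℤ.+ k     <⟨ ℤ.+-monoˡ-< k (ℤ.*-monoʳ-<-neg l (ℤ.+<+ 1<r)) ⟩
    + 1 ℤ.* l ℤ.+ k     ≡⟨ cong (ℤ._+ k) (ℤ.*-identityˡ l) ⟩
    l ℤ.+ k             ≡⟨ ℤ.+-comm l k ⟩
    k ℤ.+ l             ∎))
    where open ℤ.≤-Reasoning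

  yⁿ∙x≡ : ∀ n k b c → (n ×ᴳ (ℤ.0ℤ , c)) ∙ (k , b) ≡ (k , fromℕ n * c + b)
  yⁿ∙x≡ n k b c = trans (cong (_∙ (k , b)) (×-base n c))
    (cong₂ _,_ (ℤ.+-identityˡ k) (cong (λ u → fromℕ n * c + u) (*-identityˡ b)))

  x∙y≡ : ∀ k b c → (k , b) ∙ (ℤ.0ℤ , c) ≡ (k , q^ k * c + b)
  x∙y≡ k b c = cong₂ _,_ (ℤ.+-identityʳ k) (+-comm b (q^ k * c))

  +-cancelʳ-< : ∀ {a b} c → a + c < b + c → a < b
  +-cancelʳ-< {a} {b} c a+c<b+c = ≰⇒> λ b≤a → <-irrefl refl (<-≤-trans a+c<b+c (+-monoˡ-≤ c b≤a))

  -- Once l = 0, all three elements have ℤ-component k, and their second components give pc + b <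
  -- qᵏc + b < rc + b. It remains to cancel b and c.
  between⇒ : ∀ {p r} x y → 1 ℕ.< p → p ℕ.≤ r →
             (p ×ᴳ y) ∙ x <ᴳ x ∙ y → x ∙ y <ᴳ (r ×ᴳ y) ∙ x →
             (fromℕ p < q^ proj₁ x) × (q^ proj₁ x < fromℕ r)
  between⇒ {p} {r} x@(k , b) y@(l , c) 1<p p≤r yᵖx<xy xy<yʳx = helper
    (squeezed⇒≡0 k l 1<p (ℕ.<-≤-trans 1<p p≤r)
      (subst (λ i → i ℤ.+ k ℤ.≤ k ℤ.+ l) (proj₁-× p y) (<ᴳ⇒proj₁-≤ yᵖx<xy))
      (subst (λ i → k ℤ.+ l ℤ.≤ i ℤ.+ k) (proj₁-× r y) (<ᴳ⇒proj₁-≤ xy<yʳx)))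
    yᵖx<xy xy<yʳx
    where
    -- The ℤ-component of `y` is a fresh variable here, so that its equation with 0 can be matched.
    helper : ∀ {l} → l ≡ ℤ.0ℤ →
             (p ×ᴳ (l , c)) ∙ x <ᴳ x ∙ (l , c) → x ∙ (l , c) <ᴳ (r ×ᴳ (l , c)) ∙ x →
             (fromℕ p < q^ k) × (q^ k < fromℕ r)
    helper refl yᵖx<xy xy<yʳx =
      *-cancelʳ-<-nonNeg c {{c≥0}} pc<qᵏc , *-cancelʳ-<-nonNeg c {{c≥0}} qᵏc<rc
      where
      pc<qᵏc : fromℕ p * c < q^ k * c
      pc<qᵏc = +-cancelʳ-< b (<ᴳ⇒proj₂-< (subst₂ _<ᴳ_ (yⁿ∙x≡ p k b c) (x∙y≡ k b c) yᵖx<xy))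
      qᵏc<rc : q^ k * c < fromℕ r * c
      qᵏc<rc = +-cancelʳ-< b (<ᴳ⇒proj₂-< (subst₂ _<ᴳ_ (x∙y≡ k b c) (yⁿ∙x≡ r k b c) xy<yʳx))
      -- A negative c would turn p ≤ r into rc ≤ pc, against pc < qᵏc < rc.
      c≥0 : NonNegative c
      c≥0 = nonNegative (≮⇒≥ {c} λ c<0 → <-irrefl refl (<-≤-trans (<-trans pc<qᵏc qᵏc<rc)
              (*-monoʳ-≤-nonPos c {{nonPositive (<⇒≤ c<0)}} (fromℕ-mono-≤ p≤r))))

  -- With c = 1 and b = 0 the second components are p, qᵏ and r, up to multiplying by 1 and adding
  -- 0.
  between⇐ : ∀ {p r} k → fromℕ p < q^ k → q^ k < fromℕ r →
             let x = k , 0ℚ; y = ℤ.0ℤ , 1ℚ in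
             ((p ×ᴳ y) ∙ x <ᴳ x ∙ y) × (x ∙ y <ᴳ (r ×ᴳ y) ∙ x)
  between⇐ {p} {r} k p<qᵏ qᵏ<r =
    subst₂ _<ᴳ_ (sym (yⁿ∙x≡ p k 0ℚ 1ℚ)) (sym (x∙y≡ k 0ℚ 1ℚ))
      (inj₂ (refl , +-monoˡ-< 0ℚ (*-monoˡ-<-pos 1ℚ p<qᵏ))) ,
    subst₂ _<ᴳ_ (sym (x∙y≡ k 0ℚ 1ℚ)) (sym (yⁿ∙x≡ r k 0ℚ 1ℚ))
      (inj₂ (refl , +-monoˡ-< 0ℚ (*-monoˡ-<-pos 1ℚ qᵏ<r)))

  infix 4 _≤ᴳ?_
  _≤ᴳ?_ : Decidable _≤ᴳ_
  _≤ᴳ?_ = ×-decidable ℤ._≟_ ℤ._<?_ _≤?_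

  open AdjoinZero isGroup ≤ᴳ-isTotalOrder ∙-mono-≤ᴳ public
    using (semifield; ⊨noneBetween⇒; ⊨noneBetween⇐)

  module _ {c ℓ : Level} {p r : ℕ} where

    between⇒⊭ : ∀ k → fromℕ p < q^ k → q^ k < fromℕ r → ¬ semifield c ℓ ⊨ noneBetween p r
    between⇒⊭ k p<qᵏ qᵏ<r holds with ⊨noneBetween⇒ p r holds (k , 0ℚ) (ℤ.0ℤ , 1ℚ)
    ... | inj₁ xy≤yᵖx = <ᴳ⇒≱ (proj₁ (between⇐ {p} {r} k p<qᵏ qᵏ<r)) xy≤yᵖx
    ... | inj₂ yʳx≤xy = <ᴳ⇒≱ (proj₂ (between⇐ {p} {r} k p<qᵏ qᵏ<r)) yʳx≤xy

    ∄between⇒⊨ : 1 ℕ.< p → p ℕ.≤ r → (∀ k → fromℕ p < q^ k → ¬ q^ k < fromℕ r) →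
                 semifield c ℓ ⊨ noneBetween p r
    ∄between⇒⊨ 1<p p≤r ∄ = ⊨noneBetween⇐ p r none
      where
      none : ∀ x y → x ∙ y ≤ᴳ (p ×ᴳ y) ∙ x ⊎ (r ×ᴳ y) ∙ x ≤ᴳ x ∙ y
      -- Deciding both inequalities yields the disjunction constructively.
      none x y with x ∙ y ≤ᴳ? (p ×ᴳ y) ∙ x | (r ×ᴳ y) ∙ x ≤ᴳ? x ∙ y
      ... | yes xy≤yᵖx | _          = inj₁ xy≤yᵖx
      ... | no _       | yes yʳx≤xy = inj₂ yʳx≤xy
      ... | no xy≰yᵖx  | no yʳx≰xy  =
        contradiction qᵏ<r (∄ (proj₁ x) p<qᵏ)
        where
        bounds = between⇒ x y 1<p p≤r (≰ᴳ⇒> xy≰yᵖx) (≰ᴳ⇒> yʳx≰xy)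
        p<qᵏ = proj₁ bounds
        qᵏ<r = proj₂ bounds

-- Scaling by a positive natural number.

module ScalingByℕ (m : ℕ) .{{_ : ℕ.NonZero m}} where

  open AffineGroup (fromℕ m) {{fromℕ-positive m}} public

  -- Otherwise multiplying by the inverse power would give a power of `m` below 1, but powers of a
  -- positive natural number are at least 1.
  q^-[1+n]≤1 : ∀ n → q^ -[1+ n ] ≤ 1ℚ
  q^-[1+n]≤1 n = ≮⇒≥ λ 1<q⁻ⁿ⁻¹ → ℕ.<⇒≱ (fromℕ-cancel-< (begin-strict
    fromℕ (m ℕ.^ suc n)           ≡⟨ fromℕ-homo-^ m (suc n) ⟩
    q^ (+ suc n)                  ≡⟨ *-identityˡ _ ⟨
    1ℚ * q^ (+ suc n)             <⟨ *-monoˡ-<-pos (q^ (+ suc n)) {{q^-positive (+ suc n)}} 1<q⁻ⁿ⁻¹ ⟩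
    q^ -[1+ n ] * q^ (+ suc n)    ≡⟨ q^-homo-+ -[1+ n ] (+ suc n) ⟨
    q^ (suc n ⊖ suc n)            ≡⟨ cong q^_ (ℤ.n⊖n≡0 (suc n)) ⟩
    1ℚ                            ≡⟨ +-identityʳ 1ℚ ⟨
    fromℕ 1                       ∎)) (ℕ.m^n>0 m (suc n))
    where open ≤-Reasoning

  module _ {p : ℕ} where

    -- The only natural number strictly between p and p + 2 is p + 1, and negative powers of `m` are
    -- at most 1, hence below p.
    between⇒power : 1 ℕ.< p → ∀ k → fromℕ p < q^ k → q^ k < fromℕ (2 ℕ.+ p) →
                    ∃ λ n → m ℕ.^ n ≡ suc p
    between⇒power _ (+ n) p<qⁿ qⁿ<2+p = n , ℕ.≤-antisym
      (ℕ.s≤s⁻¹ (fromℕ-cancel-< (subst (_< fromℕ (2 ℕ.+ p)) (sym (fromℕ-homo-^ m n)) qⁿ<2+p)))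
      (fromℕ-cancel-< (subst (fromℕ p <_) (sym (fromℕ-homo-^ m n)) p<qⁿ))
    between⇒power 1<p -[1+ n ] p<q⁻ⁿ⁻¹ _ = contradiction
      (fromℕ-cancel-< (<-≤-trans p<q⁻ⁿ⁻¹
        (≤-trans (q^-[1+n]≤1 n) (≤-reflexive (sym (+-identityʳ 1ℚ))))))
      (ℕ.<-asym 1<p)

    ⊨noneBetween : ∀ {c ℓ} → 1 ℕ.< p → (∀ n → m ℕ.^ n ≢ suc p) →
                   semifield c ℓ ⊨ noneBetween p (2 ℕ.+ p)
    ⊨noneBetween 1<p mⁿ≢1+p = ∄between⇒⊨ {p = p} {2 ℕ.+ p} 1<p (ℕ.m≤n+m p 2)
      λ k p<qᵏ qᵏ<2+p → let n , mⁿ≡1+p = between⇒power 1<p k p<qᵏ qᵏ<2+p in mⁿ≢1+p n mⁿ≡1+p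

    ⊭noneBetween : ∀ {c ℓ} → m ≡ suc p → ¬ semifield c ℓ ⊨ noneBetween p (2 ℕ.+ p)
    -- Exponent 1 suffices: `m` itself is p + 1.
    ⊭noneBetween refl = between⇒⊭ {p = p} {2 ℕ.+ p} (+ 1)
      (subst (fromℕ p <_) (sym (*-identityʳ (fromℕ m))) (fromℕ-mono-< (ℕ.n<1+n p)))
      (subst (_< fromℕ (2 ℕ.+ p)) (sym (*-identityʳ (fromℕ m))) (fromℕ-mono-< (ℕ.n<1+n m)))

-- Multipliers congruent to 2 modulo 4.

multiplier : ℕ → ℕ
multiplier n = 6 ℕ.+ 4 ℕ.* n

2∣multiplier : ∀ n → 2 ∣ multiplier n
2∣multiplier n = ∣m∣n⇒∣m+n (m∣m*n 3) (∣-trans (m∣m*n {2} 2) (m∣m*n n))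

4∤multiplier : ∀ n → ¬ 4 ∣ multiplier n
4∤multiplier n 4∣6+4n =
  from-no (4 ∣? 6) (∣m+n∣m⇒∣n (subst (4 ∣_) (ℕ.+-comm 6 (4 ℕ.* n)) 4∣6+4n) (m∣m*n n))

-- Multipliers are even, so their powers with exponent at least 2 are divisible by 4, which no
-- multiplier is. Exponent 0 would give 1, which is too small.
multiplier-power-injective : ∀ {m n} k → multiplier m ℕ.^ k ≡ multiplier n → m ≡ n
multiplier-power-injective {m} {n} 1 eq = ℕ.*-cancelˡ-≡ m n 4
  (ℕ.+-cancelˡ-≡ 6 _ _ (trans (sym (ℕ.*-identityʳ (multiplier m))) eq))
multiplier-power-injective {m} {n} (suc (suc k)) eq = contradiction
  (subst (4 ∣_) eq (*-pres-∣ (2∣multiplier m)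
    (∣-trans (2∣multiplier m) (m∣m*n (multiplier m ℕ.^ k)))))
  (4∤multiplier n)

-- From separating equations to a bijection with the subsets of ℕ.

module ContinuumManyTheories
  (em : ∀ {a} → ExcludedMiddle a) {c ℓ : Level} (p : Level)
  (𝔸 : ℕ → IdempotentZeroSemifield c ℓ) (separating : ℕ → Equation)
  (⊭separating : ∀ n → ¬ 𝔸 n ⊨ separating n)
  (⊨separating : ∀ {m n} → m ≢ n → 𝔸 m ⊨ separating n)
  where

  Selected : (ℕ → Bool) → IdempotentZeroSemifield c ℓ → Set _
  Selected S A = ∃ λ n → S n ≡ true × A ≡ 𝔸 n

  -- Selected S lives in a universe that need not be below p; its truth value does.
  𝕂 : (ℕ → Bool) → Class c ℓ p
  𝕂 S A = Lift p (True (em {P = Selected S A}))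

  -- With its converse below, this recovers `S` from the theory of `𝕂 S`: the index `n` is left out
  -- exactly when `separating n` belongs to the theory.
  separating∈Eq⇒ : ∀ {S n} → Eq (𝕂 S) (separating n) → S n ≡ false
  separating∈Eq⇒ {S} {n} ∈Eq with S n in Sn
  ... | false = refl
  ... | true  = contradiction (∈Eq _ (lift (fromWitness (n , Sn , refl)))) (⊭separating n)

  separating∈Eq⇐ : ∀ {S n} → S n ≡ false → Eq (𝕂 S) (separating n)
  separating∈Eq⇐ {S} {n} Sn A A∈𝕂 with toWitness (lower A∈𝕂)
  ... | m , Sm , refl = ⊨separating λ { refl → contradiction (trans (sym Sm) Sn) λ () }

  Eq-𝕂-mono : ∀ {S S′} → S ≗ S′ → ∀ {E} → Eq (𝕂 S) E → Eq (𝕂 S′) E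
  Eq-𝕂-mono S≗S′ E∈ A A∈𝕂S′ with toWitness (lower A∈𝕂S′)
  ... | n , S′n , A≡ = E∈ A (lift (fromWitness (n , trans (S≗S′ n) S′n , A≡)))

  subsets↣theories : Injection (ℕ →-setoid Bool) (EquationalTheories c ℓ p)
  subsets↣theories = record
    { to = λ S → Eq (𝕂 S) , 𝕂 S , id , id
    ; cong = λ S≗S′ → Eq-𝕂-mono S≗S′ , Eq-𝕂-mono (sym ∘ S≗S′)
    ; injective = λ (⊆ , ⊇) n → agree
        (λ Sn → separating∈Eq⇒ (⊆ (separating∈Eq⇐ Sn)))
        (λ S′n → separating∈Eq⇒ (⊇ (separating∈Eq⇐ S′n)))
    }
    where
    agree : ∀ {b b′} → (b ≡ false → b′ ≡ false) → (b′ ≡ false → b ≡ false) → b ≡ b′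
    agree {false} {b′} ⇒ _ = sym (⇒ refl)
    agree {true} {false} _ ⇐ = ⇐ refl
    agree {true} {true} _ _ = refl

  -- Equations are countable, so a theory is determined by the set of codes of its equations;
  -- excluded middle supplies the characteristic function.
  theories↣subsets : Injection (EquationalTheories c ℓ p) (ℕ →-setoid Bool)
  theories↣subsets = record
    { to = λ (T , _) → indicator T
    ; cong = λ (⊆ , ⊇) n → does-⇔
        (mk⇔ (Product.map₂ (Product.map₂ ⊆)) (Product.map₂ (Product.map₂ ⊇))) em em
    ; injective = λ T≗T′ → indicator⇒⊆ T≗T′ , indicator⇒⊆ (sym ∘ T≗T′)
    }
    where
    Coded : ∀ {t} → Pred Equation t → ℕ → Set t
    Coded T n = ∃ λ E → encodeEquation E ≡ n × T E

    indicator : ∀ {t} → Pred Equation t → ℕ → Bool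
    indicator T n = does (em {P = Coded T n})

    does⇒ : ∀ {t} {P : Set t} (p? : Dec P) → does p? ≡ true → P
    does⇒ (yes p) _ = p

    indicator⇒⊆ : ∀ {t} {T T′ : Pred Equation t} → indicator T ≗ indicator T′ →
                  ∀ {E} → T E → T′ E
    indicator⇒⊆ {T = T} {T′} T≗T′ {E} TE
      -- The code of `E` is marked for `T`, hence for `T′`, so some `E′` in `T′` has the same code;
      -- injectivity of the coding identifies it with `E`.
      with n ← encodeEquation E in eq
      with E′ , E′↦n , T′E′ ← does⇒ (em {P = Coded T′ n})
                                (trans (sym (T≗T′ n)) (dec-true em (E , eq , TE)))
      = subst T′ (encodeEquation-injective (trans E′↦n (sym eq))) T′E′

  subsets⤖theories : Bijection (ℕ →-setoid Bool) (EquationalTheories c ℓ p)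
  subsets⤖theories = CantorBernstein.bijection em subsets↣theories theories↣subsets

-- The concrete family and the cardinality of the set of theories.

separating : ℕ → Equation
-- The bounds are `multiplier n` minus 1 and plus 1.
separating n = noneBetween (5 ℕ.+ 4 ℕ.* n) (7 ℕ.+ 4 ℕ.* n)

module _ {c ℓ : Level} where

  ⊭separating : ∀ n → ¬ ScalingByℕ.semifield (multiplier n) c ℓ ⊨ separating n
  ⊭separating n = ScalingByℕ.⊭noneBetween (multiplier n) {p = 5 ℕ.+ 4 ℕ.* n} refl

  ⊨separating : ∀ {m n} → m ≢ n → ScalingByℕ.semifield (multiplier m) c ℓ ⊨ separating n
  ⊨separating {m} {n} m≢n = ScalingByℕ.⊨noneBetween (multiplier m) {p = 5 ℕ.+ 4 ℕ.* n}
    (ℕ.s≤s (ℕ.s≤s ℕ.z≤n)) λ k eq → m≢n (multiplier-power-injective k eq)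

-- The continuum appears as the characteristic functions of subsets of ℕ, compared pointwise.
corollary5p4 : (∀ {a} → ExcludedMiddle a) →
    ∀ c ℓ p → Bijection (ℕ →-setoid Bool) (EquationalTheories c ℓ p)
corollary5p4 em c ℓ p =
  ContinuumManyTheories.subsets⤖theories em p
    (λ n → ScalingByℕ.semifield (multiplier n) c ℓ) separating ⊭separating ⊨separating
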